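{- For every $2$-connected graph $F$ and every positive integer $k$, there exists an $F$-WORM colorable graph $G$ with $W^-(G,F)=k$.
   Context: All graphs are finite and simple. For graphs $F$ and $G$, an $F$-WORM coloring of $G$ is an assignment of colors to the vertices of $G$ such that no subgraph of $G$ isomorphic to $F$ (not necessarily induced) is monochromatic (all its vertices have the same color) or rainbow (its vertices have pairwise distinct colors). $G$ is $F$-WORM colorable if it has at least one $F$-WORM coloring; in that case $W^-(G,F)$ denotes the minimum number of colors used in an $F$-WORM coloring of $G$. -}

module Defs where

open import Data.Nat using (ℕ; _≤_; _<_)
open import Data.Fin using (Fin)
open import Data.Bool using (Bool; true; false)
open import Data.Product using (Σ; _×_; ∃)
open import Relation.Binary.PropositionalEquality using (_≡_; _≢_)
open import Relation.Nullary using (¬_)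
open import Function.Definitions using (Injective)

record Graph : Set where
  field
    vertices : ℕ
    adj      : Fin vertices → Fin vertices → Bool
    adj-sym  : ∀ x y → adj x y ≡ adj y x
    adj-irr  : ∀ x → adj x x ≡ false
open Graph public

data Reach (G : Graph) (P : Fin (vertices G) → Set) :
           Fin (vertices G) → Fin (vertices G) → Set where
  here : ∀ {u} → P u → Reach G P u u
  step : ∀ {u w v} → P u → adj G u w ≡ true → Reach G P w v → Reach G P u v

Connected : Graph → Set
Connected G = ∀ u v → Reach G (λ _ → Fin (vertices G)) u v

TwoConnected : Graph → Set
TwoConnected G =
  (3 ≤ vertices G) × Connected G ×
  (∀ w u v → u ≢ w → v ≢ w → Reach G (λ x → x ≢ w) u v)

-- A (not necessarily induced) subgraph of G isomorphic to F:
-- an injective vertex map sending edges of F to edges of G.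
record Copy (F G : Graph) : Set where
  field
    emb     : Fin (vertices F) → Fin (vertices G)
    emb-inj : Injective _≡_ _≡_ emb
    emb-hom : ∀ x y → adj F x y ≡ true → adj G (emb x) (emb y) ≡ true
open Copy public

-- Colourings of G with (at most) j colours.
Colouring : Graph → ℕ → Set
Colouring G j = Fin (vertices G) → Fin j

Monochromatic : ∀ {F G j} → Colouring G j → Copy F G → Set
Monochromatic {F} c φ = ∀ x y → c (emb φ x) ≡ c (emb φ y)

Rainbow : ∀ {F G j} → Colouring G j → Copy F G → Set
Rainbow {F} c φ = ∀ x y → c (emb φ x) ≡ c (emb φ y) → x ≡ y

IsWORM : (F G : Graph) {j : ℕ} → Colouring G j → Set
IsWORM F G c = ∀ (φ : Copy F G) → ¬ Monochromatic c φ × ¬ Rainbow c φ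

WORMColourable : (F G : Graph) → Set
WORMColourable F G = ∃ λ j → Σ (Colouring G j) (IsWORM F G)

WminusIs : (G F : Graph) → ℕ → Set
WminusIs G F k =
  Σ (Colouring G k) (IsWORM F G) ×
  (∀ j → j < k → (c : Colouring G j) → ¬ IsWORM F G c)

{-# OPTIONS --safe #-}
module Submission where

-- A graph is built by placing a copy of F on every edge of an n-uniform hypergraph, n = |V(F)|. If the
-- hypergraph has no short Berge cycles, 2-connectedness makes these the only copies of F, so one needs
-- such a hypergraph that has no (k-1)-colouring without monochromatic edges, but a k-colouring whose
-- edges are neither monochromatic nor rainbow. Without the girth condition: take k large classes, and as
-- edges n-1 vertices of one class together with one vertex of another. Given k-1 colours, every class
-- has n-1 vertices of equal colour, and two classes share this colour. The girth is then raised by the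
-- partite amalgamation of Nešetřil and Rödl, whose result maps to the base hypergraph edge by edge (so
-- the k-colouring pulls back) and keeps forcing a monochromatic edge.

open import Defs
open import Data.Bool using (true) renaming (_≟_ to _≟B_)
open import Data.Empty using (⊥-elim)
open import Data.Fin using (Fin; zero; suc; punchIn; punchOut; inject≤; finToFun; funToFin) renaming (_<_ to _<F_)
open import Data.Fin.Properties using (any?; all?; +↔⊎; *↔×; finToFun-funToFin; inj⇒≟; inject≤-injective; injective⇒≤; pigeonhole; punchInᵢ≢i; punchIn-punchOut; punchOut-injective) renaming (_≟_ to _≟F_; <⇒≢ to <F⇒≢)
open import Data.List using (List; []; _∷_; length; lookup; filter; map; allFin)
open import Data.List.Properties using (length-tabulate)
open import Data.List.Membership.Propositional using (_∈_; _∉_)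
open import Data.List.Membership.Propositional.Properties using (∈-allFin; ∈-map⁺; ∈-lookup)
open import Data.List.Relation.Unary.All using (All; []; _∷_; universal)
import Data.List.Relation.Unary.All as All
open import Data.List.Relation.Unary.All.Properties using (all-filter)
import Data.List.Relation.Unary.All.Properties as AllP
open import Data.List.Relation.Unary.Any using (here; there)
open import Data.List.Relation.Unary.AllPairs using ([]; _∷_)
open import Data.List.Relation.Unary.Unique.Propositional using (Unique)
import Data.List.Relation.Unary.Unique.Propositional.Properties as UniqueP
open import Data.Nat using (ℕ; zero; suc; _+_; _*_; _^_; _⊔_; _≤_; _<_; z≤n; s≤s; _≤?_)
open import Data.Nat.Properties
open import Data.Product using (Σ; _×_; _,_; proj₁; proj₂; ∃; ∃₂)
open import Data.Product.Function.NonDependent.Propositional using (_×-↔_)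
open import Data.Product.Properties using (,-injective)
open import Data.Sum using (_⊎_; inj₁; inj₂)
open import Data.Sum.Function.Propositional using (_⊎-↔_)
open import Data.Sum.Properties using (inj₁-injective; inj₂-injective)
open import Function using (_∘_; id)
open import Function.Bundles using (_↔_; Inverse; mk⇔)
open import Function.Definitions using (Injective)
open import Function.Properties.Inverse using (↔-refl; ↔-sym; ↔-trans; ↔⇒↣)
open import Relation.Binary.Definitions using (DecidableEquality)
open import Relation.Binary.PropositionalEquality using (_≡_; _≢_; refl; sym; trans; cong; cong₂; subst)
open import Relation.Nullary using (¬_; Dec; yes; no; contradiction; does; ¬?; _×-dec_; _→-dec_)
open import Relation.Nullary.Decidable using (map′; dec-true; dec-false; does-⇔)

-- Finite types and the pigeonhole principle.

Finite : Set → Set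
Finite A = ∃ λ n → A ↔ Fin n

module _ {A : Set} (fin : Finite A) where

  index : A → Fin (proj₁ fin)
  index = Inverse.to (proj₂ fin)

  element : Fin (proj₁ fin) → A
  element = Inverse.from (proj₂ fin)

  element-index : ∀ a → element (index a) ≡ a
  element-index = Inverse.strictlyInverseʳ (proj₂ fin)

  index-element : ∀ i → index (element i) ≡ i
  index-element = Inverse.strictlyInverseˡ (proj₂ fin)

  index-injective : Injective _≡_ _≡_ index
  index-injective {a} {b} eq =
    trans (sym (element-index a)) (trans (cong element eq) (element-index b))

  element-injective : Injective _≡_ _≡_ element
  element-injective {i} {j} eq =
    trans (sym (index-element i)) (trans (cong index eq) (index-element j))

  finite-≟ : DecidableEquality A
  finite-≟ = inj⇒≟ (↔⇒↣ (proj₂ fin))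

  elements : List A
  elements = map element (allFin (proj₁ fin))

  ∈-elements : ∀ a → a ∈ elements
  ∈-elements a = subst (_∈ elements) (element-index a) (∈-map⁺ element (∈-allFin (index a)))

  finite-any? : {P : A → Set} → (∀ a → Dec (P a)) → Dec (∃ P)
  finite-any? {P} P? = map′
    (λ (i , p) → element i , p)
    (λ (a , p) → index a , subst P (sym (element-index a)) p)
    (any? (P? ∘ element))

fin-finite : ∀ {n} → Finite (Fin n)
fin-finite {n} = n , ↔-refl

⊎-finite : ∀ {A B} → Finite A → Finite B → Finite (A ⊎ B)
⊎-finite (m , f) (n , g) = m + n , ↔-trans (f ⊎-↔ g) (↔-sym +↔⊎)

×-finite : ∀ {A B} → Finite A → Finite B → Finite (A × B)
×-finite (m , f) (n , g) = m * n , ↔-trans (f ×-↔ g) (↔-sym *↔×)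

dec-true⁻ : ∀ {A : Set} (a? : Dec A) → does a? ≡ true → A
dec-true⁻ (yes a) _ = a

injective⇒surjective : ∀ {n} (f : Fin n → Fin n) → Injective _≡_ _≡_ f → ∀ j → ∃ λ i → f i ≡ j
injective⇒surjective {suc n} f f-inj j with any? (λ i → f i ≟F j)
... | yes hit = hit
... | no ¬hit = ⊥-elim (1+n≰n (injective⇒≤ {f = λ i → punchOut (j≢f i)}
                  (λ {i} {i'} eq → f-inj (punchOut-injective (j≢f i) (j≢f i') eq))))
  where
  j≢f : ∀ i → j ≢ f i
  j≢f i eq = ¬hit (i , sym eq)

uniform-bound : ∀ {n} (P : Fin n → ℕ → Set) → (∀ i {l m} → l ≤ m → P i l → P i m) →
                (∀ i → ∃ (P i)) → ∃ λ m → ∀ i → P i m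
uniform-bound {zero}  P up p = 0 , λ ()
uniform-bound {suc n} P up p
  with p zero | uniform-bound (P ∘ suc) (up ∘ suc) (p ∘ suc)
... | l , Pl | m , Pm = l ⊔ m , λ { zero    → up zero (m≤m⊔n l m) Pl
                                  ; (suc i) → up (suc i) (m≤n⊔m l m) (Pm i) }

lookup-injective : ∀ {A : Set} {xs : List A} → Unique xs → Injective _≡_ _≡_ (lookup xs)
lookup-injective (x∉ ∷ u) {zero}  {zero}  eq = refl
lookup-injective (x∉ ∷ u) {zero}  {suc j} eq = contradiction eq (All.lookup x∉ (∈-lookup j))
lookup-injective (x∉ ∷ u) {suc i} {zero}  eq = contradiction (sym eq) (All.lookup x∉ (∈-lookup i))
lookup-injective (x∉ ∷ u) {suc i} {suc j} eq = cong suc (lookup-injective u eq)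

length-filter-¬ : ∀ {A : Set} {P : A → Set} (P? : ∀ a → Dec (P a)) xs →
                  length (filter P? xs) + length (filter (¬? ∘ P?) xs) ≡ length xs
length-filter-¬ P? [] = refl
length-filter-¬ P? (x ∷ xs) with P? x
... | yes _ = cong suc (length-filter-¬ P? xs)
... | no _  = trans (+-suc _ _) (cong suc (length-filter-¬ P? xs))

list-pigeonhole : ∀ {A : Set} {k} (c : A → Fin k) p ds xs → Unique xs → All (λ x → c x ∈ ds) xs →
  length ds * p < length xs →
  ∃ λ d → ∃ λ ys → Unique ys × All (λ y → c y ≡ d) ys × p ≤ length ys
list-pigeonhole c p [] (x ∷ xs) u (() ∷ _) lt
list-pigeonhole c p (d ∷ ds) xs u inds lt with p ≤? length (filter (λ x → c x ≟F d) xs)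
... | yes p≤ = d , _ , UniqueP.filter⁺ _ u , all-filter _ xs , p≤
-- Fewer than `p` entries have colour `d`, so more than `length ds * p` remain without them.
... | no p≰  = list-pigeonhole c p ds (filter (λ x → ¬? (c x ≟F d)) xs) (UniqueP.filter⁺ _ u)
    (All.zipWith drop (all-filter _ xs , AllP.filter⁺ _ inds)) lt'
  where
  drop : ∀ {x} → (c x ≢ d) × (c x ∈ d ∷ ds) → c x ∈ ds
  drop (≢d , here ≡d) = contradiction ≡d ≢d
  drop (_ , there m)  = m
  lt' : length ds * p < length (filter (λ x → ¬? (c x ≟F d)) xs)
  lt' = +-cancelˡ-< p _ _ (≤-trans lt (≤-trans
    (≤-reflexive (sym (length-filter-¬ (λ x → c x ≟F d) xs)))
    (+-monoˡ-≤ _ (≰⇒≥ p≰))))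

monochromatic-injection : ∀ {k p n} (c : Fin n → Fin k) → k * p < n →
  ∃ λ d → ∃ λ (f : Fin p → Fin n) → Injective _≡_ _≡_ f × (∀ i → c (f i) ≡ d)
monochromatic-injection {k} {p} {n} c lt
  with list-pigeonhole c p (allFin k) (allFin n) (UniqueP.allFin⁺ n)
         (universal (λ x → ∈-allFin (c x)) (allFin n))
         (subst id (sym (cong₂ (λ a b → a * p < b) (length-tabulate {n = k} id) (length-tabulate {n = n} id))) lt)
... | d , ys , u , mono , p≤ = d , (λ i → lookup ys (inject≤ i p≤))
    , (λ eq → inject≤-injective p≤ p≤ _ _ (lookup-injective u eq))
    , (λ i → All.lookup mono (∈-lookup (inject≤ i p≤)))

-- Hypergraphs and closed Berge walks.

record Hypergraph (R : Set) : Set₁ where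
  field
    V E      : Set
    V-finite : Finite V
    E-finite : Finite E
    edge     : E → R → V
    edge-injective : ∀ e → Injective _≡_ _≡_ (edge e)

  _∈ₑ_ : V → E → Set
  v ∈ₑ e = ∃ λ s → edge e s ≡ v

  _≟ᵥ_ : DecidableEquality V
  _≟ᵥ_ = finite-≟ V-finite

  _≟ₑ_ : DecidableEquality E
  _≟ₑ_ = finite-≟ E-finite

  -- Reduced Berge walks, indexed by their first edge. Reducedness is not required where a closed
  -- walk closes up.
  data Walk : V → E → V → ℕ → Set where
    one  : ∀ {u v e} → u ∈ₑ e → v ∈ₑ e → u ≢ v → Walk u e v 1
    cons : ∀ {u w v e f l} → u ∈ₑ e → w ∈ₑ e → u ≢ w → e ≢ f → Walk w f v l → Walk u e v (suc l)

  -- A closed walk of length 1 cannot exist, by `u ≢ v` in `one`. There is none of length 2 exactly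
  -- when distinct edges share at most one vertex.
  NoClosedWalk : ℕ → Set
  NoClosedWalk g = ∀ {u e l} → l ≤ g → ¬ Walk u e u l

  NotColourable : ℕ → Set
  NotColourable k = (c : V → Fin k) → ∃₂ λ e d → ∀ s → c (edge e s) ≡ d

  walk-length>0 : ∀ {u e v l} → Walk u e v l → 1 ≤ l
  walk-length>0 (one _ _ _) = s≤s z≤n
  walk-length>0 (cons _ _ _ _ _) = s≤s z≤n

open Hypergraph

-- Partite amalgamation and its effect on girth.

module Amalgamation {R T : Set} (_≟_ : DecidableEquality T)
  (P : Hypergraph R) (part : V P → T)
  (transversal : ∀ e {s s'} → part (edge P e s) ≡ part (edge P e s') → s ≡ s')
  (t : T) (H : Hypergraph (V P)) where

  -- The vertices inj₂ (h , v) with v in the part t are junk: they lie on no edge of the amalgam.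
  place : E H → V P → V H ⊎ (E H × V P)
  place h v with part v ≟ t
  ... | yes _ = inj₁ (edge H h v)
  ... | no _  = inj₂ (h , v)

  place-on : ∀ h {v} → part v ≡ t → place h v ≡ inj₁ (edge H h v)
  place-on h {v} eq with part v ≟ t
  ... | yes _ = refl
  ... | no ≢t = contradiction eq ≢t

  place-inj₁ : ∀ h {v y} → place h v ≡ inj₁ y → part v ≡ t × edge H h v ≡ y
  place-inj₁ h {v} eq with part v ≟ t
  ... | yes ≡t = ≡t , inj₁-injective eq
  place-inj₁ h {v} () | no _

  place-inj₂ : ∀ h {v h' v'} → place h v ≡ inj₂ (h' , v') → h ≡ h' × v ≡ v'
  place-inj₂ h {v} eq with part v ≟ t
  place-inj₂ h {v} () | yes _
  ... | no _ = ,-injective (inj₂-injective eq)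

  place-injective : ∀ h → Injective _≡_ _≡_ (place h)
  place-injective h {v} {v'} eq with part v' ≟ t
  ... | yes _ = edge-injective H h (proj₂ (place-inj₁ h eq))
  ... | no _  = proj₂ (place-inj₂ h eq)

  place-overlap : ∀ {h h' v v'} → h ≢ h' → place h v ≡ place h' v' → part v ≡ t
  place-overlap {h} {h'} {v} {v'} h≢h' eq with part v' ≟ t
  ... | yes _ = proj₁ (place-inj₁ h eq)
  ... | no _  = contradiction (proj₁ (place-inj₂ h eq)) h≢h'

  -- The copy of `P` for the edge `h` has its part `t` on vertices of `h` and is otherwise new, so
  -- distinct copies meet only in the part `t`. As edges of `H` are indexed by `V P`, a
  -- monochromatic `h` makes the whole part `t` of its copy monochromatic.
  amalgam : Hypergraph R
  amalgam = record
    { V = V H ⊎ (E H × V P)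
    ; E = E H × E P
    ; V-finite = ⊎-finite (V-finite H) (×-finite (E-finite H) (V-finite P))
    ; E-finite = ×-finite (E-finite H) (E-finite P)
    ; edge = λ (h , e) s → place h (edge P e s)
    ; edge-injective = λ (h , e) eq → transversal e (cong part (place-injective h eq))
    }

  amalgam-part : V amalgam → T
  amalgam-part (inj₁ _)       = t
  amalgam-part (inj₂ (_ , v)) = part v

  part-place : ∀ h v → amalgam-part (place h v) ≡ part v
  part-place h v with part v ≟ t
  ... | yes ≡t = sym ≡t
  ... | no _   = refl

  -- A walk in the amalgam, cut where it passes from one copy of P to another.
  data Segments (u : V amalgam) (h : E H) (e : E P) (x : V amalgam) : ℕ → Set where
    last : ∀ {u₀ x₀ l} → place h u₀ ≡ u → place h x₀ ≡ x → Walk P u₀ e x₀ l → Segments u h e x l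
    next : ∀ {u₀ y₀ h' e' l l'} → place h u₀ ≡ u → part y₀ ≡ t → Walk P u₀ e y₀ l →
           h ≢ h' → Segments (inj₁ (edge H h y₀)) h' e' x l' → Segments u h e x (l + l')

  segments : ∀ {u h e x l} → Walk amalgam u (h , e) x l → Segments u h e x l
  segments (one (s , refl) (s' , refl) u≢x) = last refl refl (one (s , refl) (s' , refl) (u≢x ∘ cong (place _)))
  segments {h = h} (cons {f = h' , e'} (s , refl) (s' , refl) u≢w e≢f walk) with _≟ₑ_ H h h' | segments walk
  -- The common vertex of the two edges lies in two different copies, hence in the part `t` by
  -- `place-overlap`; the walk is cut there.
  ... | no h≢h' | segs = next refl on-t (one (s , refl) (s' , refl) (u≢w ∘ cong (place _))) h≢h'
                           (subst (λ w → Segments w h' e' _ _) (place-on h on-t) segs)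
    where
    start : ∀ {w x l} → Segments w h' e' x l → ∃ λ w₀ → w ≡ place h' w₀
    start (last eq _ _)     = _ , sym eq
    start (next eq _ _ _ _) = _ , sym eq
    on-t = place-overlap h≢h' (proj₂ (start segs))
  ... | yes refl | last eq eqx w = last refl eqx
        (cons (s , refl) (s' , sym (place-injective h eq)) (λ eq' → u≢w (trans (cong (place h) eq') eq))
          (e≢f ∘ cong (h ,_)) w)
  ... | yes refl | next eq on-t w h≢ segs = next refl on-t
        (cons (s , refl) (s' , sym (place-injective h eq)) (λ eq' → u≢w (trans (cong (place h) eq') eq))
          (e≢f ∘ cong (h ,_)) w) h≢ segs

  -- An edge has at most one vertex in each part, so a single edge cannot join two distinct vertices
  -- of the part `t`.
  walk-within-part : ∀ {u e v l} → part u ≡ t → part v ≡ t → Walk P u e v l → 2 ≤ l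
  walk-within-part u-t v-t (one (s , refl) (s' , refl) u≢v) =
    contradiction (cong (edge P _) (transversal _ (trans u-t (sym v-t)))) u≢v
  walk-within-part u-t v-t (cons _ _ _ _ w) = s≤s (walk-length>0 P w)

  module _ {g} (P-girth : NoClosedWalk P (suc g)) (H-girth : NoClosedWalk H g) where

    -- If the ends agreed, injectivity of `edge H h` would make the walk in `P` closed.
    ends-distinct : ∀ {u e v l} → l ≤ suc g → Walk P u e v l → ∀ h → edge H h u ≢ edge H h v
    ends-distinct l≤ w h eq with edge-injective H h eq
    ... | refl = P-girth l≤ w

    -- A segment joining two vertices of the part t has length at least 2: this is the gain in girth.
    to-glued : ∀ {y h e z l} → l ≤ suc g → Segments (inj₁ y) h e (inj₁ z) l →
               ∃ λ n → n < l × Walk H y h z n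
    to-glued {h = h} l≤ (last eq eqz w) with place-inj₁ h eq | place-inj₁ h eqz
    ... | u-t , refl | z-t , refl =
      1 , walk-within-part u-t z-t w , one (_ , refl) (_ , refl) (ends-distinct l≤ w h)
    to-glued {h = h} l≤ (next {l = l} {l'} eq y-t w h≢h' segs) with place-inj₁ h eq | to-glued (m+n≤o⇒n≤o l l≤) segs
    ... | _ , refl | n , n<l' , walk =
      suc n , +-mono-≤ (walk-length>0 P w) n<l' ,
      cons (_ , refl) (_ , refl) (ends-distinct (m+n≤o⇒m≤o l l≤) w h) h≢h' walk

    -- The last segment lies in the copy `hx` and enters it at a vertex of the edge `hx`; the
    -- segments before it project to `H` as in `to-glued`. If there are none, the first alternative
    -- holds.
    to-copy : ∀ {y h e hx vx l} → l ≤ suc g → Segments (inj₁ y) h e (inj₂ (hx , vx)) l →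
              (h ≡ hx × ∃ λ y₀ → edge H hx y₀ ≡ y) ⊎
              (∃₂ λ z₀ n → n < l × Walk H y h (edge H hx z₀) n)
    to-copy {h = h} l≤ (last eq eqx w) with place-inj₁ h eq | place-inj₂ h eqx
    ... | u-t , refl | refl , _ = inj₁ (refl , _ , refl)
    to-copy {h = h} l≤ (next {l = l} {l'} eq y-t w h≢h' segs) with place-inj₁ h eq | to-copy (m+n≤o⇒n≤o l l≤) segs
    ... | u-t , refl | inj₁ (refl , y₀ , y₀≡) =
      inj₂ (y₀ , 1 , ≤-trans (walk-within-part u-t y-t w) (m≤m+n l l') ,
            one (_ , refl) (_ , sym y₀≡) (λ eq' → ends-distinct (m+n≤o⇒m≤o l l≤) w h (trans eq' y₀≡)))
    ... | u-t , refl | inj₂ (z₀ , n , n<l' , walk) =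
      inj₂ (z₀ , suc n , +-mono-≤ (walk-length>0 P w) n<l' ,
            cons (_ , refl) (_ , refl) (ends-distinct (m+n≤o⇒m≤o l l≤) w h) h≢h' walk)

    no-closed-segments : ∀ {x h e l} → l ≤ suc g → ¬ Segments x h e x l
    no-closed-segments {inj₁ y} l≤ segs with to-glued l≤ segs
    ... | n , n<l , walk = H-girth (≤-pred (≤-trans n<l l≤)) walk
    no-closed-segments {inj₂ _} {h} l≤ (last eq eqx w)
      with place-inj₂ h eq | place-inj₂ h eqx
    ... | refl , refl | _ , refl = P-girth l≤ w
    no-closed-segments {inj₂ _} {h} l≤ (next {y₀ = y₀} {l = l} eq y-t w h≢h' segs)
      with place-inj₂ h eq | to-copy (m+n≤o⇒n≤o l l≤) segs
    ... | refl , refl | inj₁ (refl , _) = h≢h' refl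
    -- The walk leaves the copy `h` through `y₀` and comes back through `z₀`. If these differ in
    -- `H`, the edge `h` joins them and closes the projected walk; this extra edge is paid for by
    -- the first segment, of length at least 1.
    ... | refl , refl | inj₂ (z₀ , n , n<l' , walk) with _≟ᵥ_ H (edge H h z₀) (edge H h y₀)
    ...   | yes eq' rewrite eq' = H-girth (≤-trans (n≤1+n n) n<g) walk
      where n<g = ≤-pred (≤-trans (+-mono-≤ (walk-length>0 P w) n<l') l≤)
    ...   | no z≢y = H-girth n<g (cons (_ , refl) (_ , refl) z≢y h≢h' walk)
      where n<g = ≤-pred (≤-trans (+-mono-≤ (walk-length>0 P w) n<l') l≤)

    -- The bound assumed for `H` is one less than the bound obtained, which makes recursion on the
    -- girth possible.
    amalgam-girth : NoClosedWalk amalgam (suc g)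
    amalgam-girth l≤ walk = no-closed-segments l≤ (segments walk)

-- Hypergraphs of large girth without proper `k`-colourings.

injective? : ∀ {m n} (f : Fin m → Fin n) → Dec (∀ i j → f i ≡ f j → i ≡ j)
injective? f = all? λ i → all? λ j → (f i ≟F f j) →-dec (i ≟F j)

-- Codes of non-injective maps get the junk value inject≤.
injection : ∀ {m n} → m ≤ n → Fin (n ^ m) → Σ (Fin m → Fin n) (Injective _≡_ _≡_)
injection m≤n e with injective? (finToFun e)
... | yes inj = finToFun e , λ {i} {j} → inj i j
... | no _    = (λ i → inject≤ i m≤n) , inject≤-injective m≤n m≤n _ _

injection-surjective : ∀ {m n} (m≤n : m ≤ n) (f : Fin m → Fin n) → Injective _≡_ _≡_ f →
                       ∃ λ e → ∀ i → proj₁ (injection m≤n e) i ≡ f i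
injection-surjective {m} {n} m≤n f f-inj = funToFin f , agree
  where
  f≗ = finToFun-funToFin f
  agree : ∀ i → proj₁ (injection m≤n (funToFin f)) i ≡ f i
  agree i with injective? (finToFun {n} {m} (funToFin f))
  ... | yes _   = f≗ i
  ... | no ¬inj = contradiction (λ a b eq → f-inj (trans (sym (f≗ a)) (trans eq (f≗ b)))) ¬inj

module Sparse (k : ℕ) where

  module _ {R : Set} (R-finite : Finite R) where

    private
      p N : ℕ
      p = proj₁ R-finite
      -- More than `k * p` vertices serve the pigeonhole; another `p` ensures `p ≤ N` even for
      -- `k = 0`.
      N = suc (suc k * p)

      p≤N : p ≤ N
      p≤N = ≤-trans (m≤m+n p (k * p)) (n≤1+n _)

    complete : Hypergraph R
    complete = record
      { V = Fin N
      ; E = Fin (N ^ p)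
      ; V-finite = fin-finite
      ; E-finite = fin-finite
      ; edge = λ e r → proj₁ (injection p≤N e) (index R-finite r)
      ; edge-injective = λ e eq → index-injective R-finite (proj₂ (injection p≤N e) eq)
      }

    complete-notColourable : NotColourable complete k
    complete-notColourable c with monochromatic-injection {p = p} c (s≤s (m≤n+m (k * p) p))
    ... | d , f , f-inj , mono with injection-surjective p≤N f f-inj
    ...   | e , e≗f = e , d , λ r → trans (cong c (e≗f (index R-finite r))) (mono (index R-finite r))

  -- A hypergraph over B that still forces a monochromatic edge once the parts outside ts are monochromatic.
  record Partite {R : Set} (B : Hypergraph R) (g : ℕ) (ts : List (V B)) : Set₁ where
    field
      total     : Hypergraph R
      part      : V total → V B
      project   : E total → E B
      part-edge : ∀ e s → part (edge total e s) ≡ edge B (project e) s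
      girth     : NoClosedWalk total g
      forces    : (c : V total → Fin k) →
                  (∀ j → j ∉ ts → ∃ λ d → ∀ v → part v ≡ j → c v ≡ d) →
                  ∃₂ λ e d → ∀ s → c (edge total e s) ≡ d

  module _ {R : Set} (R-finite : Finite R) (B : Hypergraph R) (B-not : NotColourable B k) where

    disjointEdges : Hypergraph R
    disjointEdges = record
      { V = E B × R
      ; E = E B
      ; V-finite = ×-finite (E-finite B) R-finite
      ; E-finite = E-finite B
      ; edge = _,_
      ; edge-injective = λ e eq → proj₂ (,-injective eq)
      }

    disjointEdges-girth : ∀ {g} → NoClosedWalk disjointEdges g
    disjointEdges-girth _ (one _ _ u≢u) = u≢u refl
    disjointEdges-girth _ (cons _ (_ , refl) _ e≢f (one (_ , refl) _ _)) = e≢f refl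
    disjointEdges-girth _ (cons _ (_ , refl) _ e≢f (cons (_ , refl) _ _ _ _)) = e≢f refl

    -- If every part is monochromatic, the colouring descends to `B`, which has a monochromatic
    -- edge.
    initial : ∀ g → Partite B g []
    initial g = record
      { total = disjointEdges
      ; part = λ (e , s) → edge B e s
      ; project = id
      ; part-edge = λ e s → refl
      ; girth = disjointEdges-girth
      ; forces = forces
      }
      where
      forces : (c : V disjointEdges → Fin k) →
        (∀ j → j ∉ [] → ∃ λ d → ∀ v → edge B (proj₁ v) (proj₂ v) ≡ j → c v ≡ d) →
        ∃₂ λ e d → ∀ s → c (e , s) ≡ d
      forces c const with B-not (λ j → proj₁ (const j λ ()))
      ... | e , d , mono = e , d , λ s → trans (proj₂ (const (edge B e s) λ ()) (e , s) refl) (mono s)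

    module _ {g} (sparse : ∀ {S} → Finite S → Σ (Hypergraph S) λ H → NoClosedWalk H g × NotColourable H k) where

      -- Some edge `h` of `H` is monochromatic, so the part `t` is monochromatic within the copy of
      -- `Q` on `h`. The parts outside `t ∷ ts` are so by assumption, and `forces` of `Q` applies to
      -- that copy.
      amalgamate : ∀ t ts → Partite B (suc g) ts → Partite B (suc g) (t ∷ ts)
      amalgamate t ts Q with sparse (V-finite (Partite.total Q))
      ... | H , H-girth , H-not = record
        { total = amalgam
        ; part = amalgam-part
        ; project = λ (h , e) → project e
        ; part-edge = λ (h , e) s → trans (part-place h (edge total e s)) (part-edge e s)
        ; girth = amalgam-girth girth H-girth
        ; forces = forces'
        }
        where
        open Partite Q
        transversal : ∀ e {s s'} → part (edge total e s) ≡ part (edge total e s') → s ≡ s'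
        transversal e {s} {s'} eq =
          edge-injective B (project e) (trans (sym (part-edge e s)) (trans eq (part-edge e s')))
        open Amalgamation (_≟ᵥ_ B) total part transversal t H
        forces' : (c : V amalgam → Fin k) →
          (∀ j → j ∉ t ∷ ts → ∃ λ d → ∀ v → amalgam-part v ≡ j → c v ≡ d) →
          ∃₂ λ e d → ∀ s → c (edge amalgam e s) ≡ d
        forces' c const with H-not (c ∘ inj₁)
        ... | h , a , mono with forces (c ∘ place h) const'
          where
          const' : ∀ j → j ∉ ts → ∃ λ d → ∀ v → part v ≡ j → c (place h v) ≡ d
          const' j j∉ with _≟ᵥ_ B j t
          ... | yes refl = a , λ v v-t → trans (cong c (place-on h v-t)) (mono v)
          ... | no j≢t with const j (λ { (here eq) → j≢t eq ; (there j∈) → j∉ j∈ })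
          ...   | d , eq = d , λ v v-j → eq (place h v) (trans (part-place h v) v-j)
        ...   | e , d , e-mono = (h , e) , d , e-mono

      amalgamate-all : ∀ ts → Partite B (suc g) ts
      amalgamate-all []       = initial (suc g)
      amalgamate-all (t ∷ ts) = amalgamate t ts (amalgamate-all ts)

  -- Recursion on `g`: each part of `B` is amalgamated using a hypergraph of girth bound `g` whose
  -- uniformity is the vertex set built so far. Hence `R` and `B` are arbitrary, and the recursive
  -- call starts from a complete hypergraph of that uniformity.
  sparse-cover : ∀ g {R} → Finite R → (B : Hypergraph R) → NotColourable B k → Partite B g (elements (V-finite B))
  sparse-cover zero R-finite B B-not = record
    { total = B
    ; part = id
    ; project = id
    ; part-edge = λ _ _ → refl
    ; girth = λ l≤0 walk → 1+n≰n (≤-trans (walk-length>0 B walk) l≤0)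
    ; forces = λ c _ → B-not c
    }
  sparse-cover (suc g) R-finite B B-not = amalgamate-all R-finite B B-not sparse (elements (V-finite B))
    where
    sparse : ∀ {S} → Finite S → Σ (Hypergraph S) λ H → NoClosedWalk H g × NotColourable H k
    sparse S-finite = total , girth , λ c → forces c λ j j∉ → contradiction (∈-elements (V-finite K) j) j∉
      where
      K = complete S-finite
      open Partite (sparse-cover g S-finite K (complete-notColourable S-finite))

-- The base hypergraph with `suc k` classes.

module BaseHypergraph {k m} (C : Hypergraph (Fin (2 + m))) (C-not : NotColourable C k) where

  -- The class `punchIn i j` of the single outside vertex ranges over all classes other than `i`.
  -- Naming that vertex by an edge `h'` lets `base-notColourable` pick it from a monochromatic edge
  -- of its class.
  base-edge : (Fin (suc k) × Fin k) × (E C × E C) → Fin (3 + m) → Fin (suc k) × V C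
  base-edge ((i , j) , (h , h')) zero    = punchIn i j , edge C h' zero
  base-edge ((i , j) , (h , h')) (suc s) = i , edge C h s

  base-edge-injective : ∀ e → Injective _≡_ _≡_ (base-edge e)
  base-edge-injective e {zero} {zero} eq = refl
  base-edge-injective ((i , j) , _) {zero} {suc _} eq = contradiction (cong proj₁ eq) (punchInᵢ≢i i j)
  base-edge-injective ((i , j) , _) {suc _} {zero} eq = contradiction (sym (cong proj₁ eq)) (punchInᵢ≢i i j)
  base-edge-injective (_ , (h , _)) {suc _} {suc _} eq = cong suc (edge-injective C h (cong proj₂ eq))

  base : Hypergraph (Fin (3 + m))
  base = record
    { V = Fin (suc k) × V C
    ; E = (Fin (suc k) × Fin k) × (E C × E C)
    ; V-finite = ×-finite fin-finite (V-finite C)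
    ; E-finite = ×-finite (×-finite fin-finite fin-finite) (×-finite (E-finite C) (E-finite C))
    ; edge = base-edge
    ; edge-injective = base-edge-injective
    }

  base-notColourable : NotColourable base k
  base-notColourable c = forced (pigeonhole (n<1+n k) d)
    where
    e : Fin (suc k) → E C
    e i = proj₁ (C-not (λ v → c (i , v)))
    d : Fin (suc k) → Fin k
    d i = proj₁ (proj₂ (C-not (λ v → c (i , v))))
    in-class : ∀ i s → c (i , edge C (e i) s) ≡ d i
    in-class i = proj₂ (proj₂ (C-not (λ v → c (i , v))))
    forced : (∃₂ λ i i' → i <F i' × d i ≡ d i') → ∃₂ λ e d → ∀ s → c (base-edge e s) ≡ d
    forced (i , i' , i<i' , eq) = ((i , punchOut i≢i') , (e i , e i')) , d i , mono
      where
      i≢i' = <F⇒≢ i<i'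
      mono : ∀ s → c (base-edge ((i , punchOut i≢i') , (e i , e i')) s) ≡ d i
      mono zero    = trans (cong (λ a → c (a , edge C (e i') zero)) (punchIn-punchOut i≢i'))
                           (trans (in-class i' zero) (sym eq))
      mono (suc s) = in-class i s

Neither : ∀ {n k} → (Fin n → Fin k) → Set
Neither f = (∃₂ λ s s' → f s ≢ f s') × (∃₂ λ s s' → s ≢ s' × f s ≡ f s')

base-hypergraph : ∀ k {n} → 3 ≤ n → Σ (Hypergraph (Fin n)) λ B → NotColourable B k ×
                  Σ (V B → Fin (suc k)) λ χ → ∀ e → Neither (χ ∘ edge B e)
base-hypergraph k (s≤s (s≤s (s≤s {n = m} z≤n))) = base , base-notColourable , proj₁ , neither
  where
  open Sparse k
  open BaseHypergraph (complete fin-finite) (complete-notColourable fin-finite)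
  neither : ∀ e → Neither (proj₁ ∘ base-edge e)
  -- Slot 0 lies outside the class of slots 1 and 2; slot 2 exists because `3 ≤ n`.
  neither ((i , j) , _) = (zero , suc zero , punchInᵢ≢i i j) , (suc zero , suc (suc zero) , (λ ()) , refl)

-- Images of 2-connected graphs in hypergraphs of large girth.

length-Reach : ∀ {G Q u v} → Reach G Q u v → ℕ
length-Reach (here _)     = 0
length-Reach (step _ _ r) = suc (length-Reach r)

-- The girth must be fixed before the hypergraph is built; `2 + m` will be enough.
bounded-paths : ∀ F → TwoConnected F → ∃ λ m → ∀ w u v → u ≢ w → v ≢ w →
                Σ (Reach F (_≢ w) u v) λ r → length-Reach r ≤ m
bounded-paths F (_ , _ , avoid) =
  uniform-bound _ (λ w l≤ p u v u≢ v≢ → up l≤ (p u v u≢ v≢)) λ w →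
  uniform-bound _ (λ u l≤ p v u≢ v≢ → up l≤ (p v u≢ v≢)) λ u →
  uniform-bound _ (λ v l≤ p u≢ v≢ → up l≤ (p u≢ v≢)) λ v → path w u v
  where
  up : ∀ {w u v l m} → l ≤ m → Σ (Reach F (_≢ w) u v) (λ r → length-Reach r ≤ l) →
       Σ (Reach F (_≢ w) u v) (λ r → length-Reach r ≤ m)
  up l≤m (r , r≤l) = r , ≤-trans r≤l l≤m
  path : ∀ w u v → ∃ λ m → u ≢ w → v ≢ w → Σ (Reach F (_≢ w) u v) λ r → length-Reach r ≤ m
  path w u v with u ≟F w | v ≟F w
  ... | yes u≡ | _      = 0 , λ u≢ → contradiction u≡ u≢
  ... | no _   | yes v≡ = 0 , λ _ v≢ → contradiction v≡ v≢
  ... | no u≢  | no v≢  = length-Reach (avoid w u v u≢ v≢) , λ _ _ → avoid w u v u≢ v≢ , ≤-refl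

module TwoConnectedImage {R : Set} (H : Hypergraph R) (F : Graph)
  (ψ : Fin (vertices F) → V H) (ψ-injective : Injective _≡_ _≡_ ψ)
  (edge-over : ∀ x y → adj F x y ≡ true → ∃ λ e → _∈ₑ_ H (ψ x) e × _∈ₑ_ H (ψ y) e) where

  module _ (x : V H) (e₀ : E H) (x∈e₀ : _∈ₑ_ H x e₀) where

    -- Reduced walks from v to x that meet x only at the end and have last edge e₀.
    data Return (v : V H) : E H → ℕ → Set where
      last : _∈ₑ_ H v e₀ → v ≢ x → Return v e₀ 1
      cons : ∀ {w e f l} → _∈ₑ_ H v e → _∈ₑ_ H w e → v ≢ x → v ≢ w → e ≢ f →
             Return w f l → Return v e (suc l)

    return-walk : ∀ {v e l} → Return v e l → Walk H v e x l
    return-walk (last v∈ v≢x)           = one v∈ x∈e₀ v≢x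
    return-walk (cons v∈ w∈ _ v≢w e≢f r) = cons v∈ w∈ v≢w e≢f (return-walk r)

    return-start : ∀ {v e l} → Return v e l → v ≢ x
    return-start (last _ v≢x)         = v≢x
    return-start (cons _ _ v≢x _ _ _) = v≢x

    -- Reducedness is restored as follows: a repeated vertex adds nothing, a repeated edge is merged
    -- with the first edge of `r`, and that edge is dropped if `v` is also its far end.
    prepend : ∀ {v w e f l} → v ≢ x → _∈ₑ_ H v e → _∈ₑ_ H w e → Return w f l →
              ∃₂ λ f' l' → l' ≤ suc l × Return v f' l'
    prepend {v} {w} {e} {f} v≢x v∈ w∈ r with _≟ᵥ_ H v w
    ... | yes refl = _ , _ , n≤1+n _ , r
    ... | no v≢w with _≟ₑ_ H e f
    ...   | no e≢f = _ , _ , ≤-refl , cons v∈ w∈ v≢x v≢w e≢f r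
    prepend v≢x v∈ w∈ (last _ _) | no v≢w | yes refl = _ , _ , n≤1+n _ , last v∈ v≢x
    prepend {v} v≢x v∈ w∈ (cons {w'} _ w'∈ _ _ e≢f r) | no v≢w | yes refl with _≟ᵥ_ H v w'
    ... | yes refl = _ , _ , ≤-trans (n≤1+n _) (n≤1+n _) , r
    ... | no v≢w'  = _ , _ , n≤1+n _ , cons v∈ w'∈ v≢x v≢w' e≢f r

    -- If `e` is already the first edge of `r`, the walk goes from `x` directly to the second vertex
    -- of `r`, which exists because `r` ends with `e₀` and `e ≢ e₀`.
    close : ∀ {v e f l} → e ≢ e₀ → _∈ₑ_ H x e → _∈ₑ_ H v e → Return v f l →
            ∃₂ λ f' l' → l' ≤ suc l × Walk H x f' x l'
    close {e = e} {f} e≢e₀ x∈ v∈ r with _≟ₑ_ H e f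
    ... | no e≢f = _ , _ , ≤-refl , cons x∈ v∈ (return-start r ∘ sym) e≢f (return-walk r)
    close e≢e₀ x∈ v∈ (last _ _) | yes refl = contradiction refl e≢e₀
    close e≢e₀ x∈ v∈ (cons _ w∈ _ _ e≢f r) | yes refl =
      _ , _ , n≤1+n _ , cons x∈ w∈ (return-start r ∘ sym) e≢f (return-walk r)

  module _ {m} (paths : ∀ w u v → u ≢ w → v ≢ w → Σ (Reach F (_≢ w) u v) λ r → length-Reach r ≤ m)
    (girth : NoClosedWalk H (2 + m)) where

    private
      adj⇒≢ : ∀ {x y} → adj F x y ≡ true → y ≢ x
      adj⇒≢ {x} xy refl with trans (sym xy) (adj-irr F x)
      ... | ()

    return-along : ∀ {x y e₀} (x∈ : _∈ₑ_ H (ψ x) e₀) → _∈ₑ_ H (ψ y) e₀ →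
      ∀ {z} (r : Reach F (_≢ x) z y) → ∃₂ λ f l → l ≤ suc (length-Reach r) × Return (ψ x) e₀ x∈ (ψ z) f l
    return-along x∈ y∈ (here y≢x) = _ , _ , ≤-refl , last y∈ (y≢x ∘ ψ-injective)
    return-along x∈ y∈ (step z≢x zw r) with return-along x∈ y∈ r | edge-over _ _ zw
    ... | f , l , l≤ , ret | e , z∈ , w∈ with prepend _ _ x∈ (z≢x ∘ ψ-injective) z∈ w∈ ret
    ...   | f' , l' , l'≤ , ret' = f' , l' , ≤-trans l'≤ (s≤s l≤) , ret'

    -- Otherwise a path from `z` to `y` avoiding `x`, provided by 2-connectedness, would close up
    -- through `e` and `e'` at `ψ x`. The closed walk has length at most `2 + m`: `m` for the path
    -- and one for each of `e` and `e'`.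
    edges-agree : ∀ {x y z e e'} → adj F x y ≡ true → adj F x z ≡ true →
      _∈ₑ_ H (ψ x) e → _∈ₑ_ H (ψ y) e → _∈ₑ_ H (ψ x) e' → _∈ₑ_ H (ψ z) e' → e' ≡ e
    edges-agree {x} {y} {z} {e} {e'} xy xz x∈e y∈e x∈e' z∈e' with _≟ₑ_ H e' e
    ... | yes eq = eq
    ... | no e'≢e with paths x z y (adj⇒≢ xz) (adj⇒≢ xy)
    ...   | r , r≤ with return-along x∈e y∈e r
    ...     | f , l , l≤ , ret with close _ _ x∈e e'≢e x∈e' z∈e' ret
    ...       | f' , l' , l'≤ , walk =
      contradiction walk (girth (≤-trans l'≤ (s≤s (≤-trans l≤ (s≤s r≤)))))

    spread : ∀ {Q x y e} → adj F x y ≡ true → _∈ₑ_ H (ψ x) e → _∈ₑ_ H (ψ y) e →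
             ∀ {z} → Reach F Q x z → _∈ₑ_ H (ψ z) e
    spread xy x∈ y∈ (here _) = x∈
    spread {x = x} xy x∈ y∈ (step {w = w} _ xw r) with edge-over _ _ xw
    ... | e' , x∈e' , w∈e' with edges-agree xy xw x∈ y∈ x∈e' w∈e'
    -- The edge of `F` just traversed, reversed, is the known edge at `w`.
    ...   | refl = spread (trans (adj-sym F w x) xw) w∈e' x∈e' r

    in-one-edge : Connected F → ∀ {x y} → x ≢ y → ∃ λ e → ∀ z → _∈ₑ_ H (ψ z) e
    in-one-edge connected {x} {y} x≢y with connected x y
    ... | here _ = contradiction refl x≢y
    ... | step _ xw _ with edge-over _ _ xw
    ...   | e , x∈ , w∈ = e , λ z → spread xw x∈ w∈ (connected x z)

-- The graph with a copy of `F` on every hyperedge.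

module Realisation (F : Graph) (H : Hypergraph (Fin (vertices F))) where

  Adjacent : V H → V H → Set
  Adjacent u v = ∃ λ e → ∃₂ λ i j → adj F i j ≡ true × edge H e i ≡ u × edge H e j ≡ v

  adjacent? : ∀ u v → Dec (Adjacent u v)
  adjacent? u v = finite-any? (E-finite H) λ e → any? λ i → any? λ j →
    (adj F i j ≟B true) ×-dec (_≟ᵥ_ H (edge H e i) u ×-dec _≟ᵥ_ H (edge H e j) v)

  Adjacent-sym : ∀ {u v} → Adjacent u v → Adjacent v u
  Adjacent-sym (e , i , j , ij , u≡ , v≡) = e , j , i , trans (adj-sym F j i) ij , v≡ , u≡

  Adjacent-irr : ∀ {u} → ¬ Adjacent u u
  Adjacent-irr (e , i , j , ij , i≡ , j≡) with edge-injective H e (trans i≡ (sym j≡))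
  ... | refl with trans (sym ij) (adj-irr F i)
  ...   | ()

  vertex : Fin (proj₁ (V-finite H)) → V H
  vertex = element (V-finite H)

  graph : Graph
  graph = record
    { vertices = proj₁ (V-finite H)
    ; adj = λ x y → does (adjacent? (vertex x) (vertex y))
    ; adj-sym = λ x y → does-⇔ (mk⇔ Adjacent-sym Adjacent-sym)
        (adjacent? (vertex x) (vertex y)) (adjacent? (vertex y) (vertex x))
    ; adj-irr = λ x → dec-false (adjacent? (vertex x) (vertex x)) Adjacent-irr
    }

  adj⇒Adjacent : ∀ x y → adj graph x y ≡ true → Adjacent (vertex x) (vertex y)
  adj⇒Adjacent x y = dec-true⁻ (adjacent? (vertex x) (vertex y))

  edge-copy : E H → Copy F graph
  edge-copy e = record
    { emb = λ i → index (V-finite H) (edge H e i)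
    ; emb-inj = λ eq → edge-injective H e (index-injective (V-finite H) eq)
    ; emb-hom = λ i j ij → dec-true (adjacent? (vertex (index (V-finite H) (edge H e i))) (vertex (index (V-finite H) (edge H e j))))
        (e , i , j , ij , sym (element-index (V-finite H) _) , sym (element-index (V-finite H) _))
    }

  not-worm : ∀ {k} → NotColourable H k → ∀ {j} → j ≤ k → (c : Colouring graph j) → ¬ IsWORM F graph c
  not-worm H-not j≤k c worm with H-not (λ v → inject≤ (c (index (V-finite H) v)) j≤k)
  ... | e , d , mono = proj₁ (worm (edge-copy e)) λ x y →
    inject≤-injective j≤k j≤k _ _ (trans (mono x) (sym (mono y)))

  -- Each copy of `F` lies in one hyperedge and has as many vertices, so it covers the hyperedge and
  -- shows exactly its colours.
  worm : ∀ {m k} → (∀ w u v → u ≢ w → v ≢ w → Σ (Reach F (_≢ w) u v) λ r → length-Reach r ≤ m) →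
         NoClosedWalk H (2 + m) → TwoConnected F → (χ : V H → Fin k) →
         (∀ e → Neither (χ ∘ edge H e)) → IsWORM F graph (χ ∘ vertex)
  worm paths girth (3≤n , connected , _) χ neither φ = not-mono , not-rainbow
    where
    ψ : Fin (vertices F) → V H
    ψ = vertex ∘ emb φ
    ψ-injective : Injective _≡_ _≡_ ψ
    ψ-injective eq = emb-inj φ (element-injective (V-finite H) eq)
    edge-over : ∀ x y → adj F x y ≡ true → ∃ λ e → _∈ₑ_ H (ψ x) e × _∈ₑ_ H (ψ y) e
    edge-over x y xy with adj⇒Adjacent (emb φ x) (emb φ y) (emb-hom φ x y xy)
    ... | e , i , j , _ , x≡ , y≡ = e , (i , x≡) , (j , y≡)
    open TwoConnectedImage H F ψ ψ-injective edge-over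
    two-vertices : ∀ {n} → 3 ≤ n → ∃₂ λ (x y : Fin n) → x ≢ y
    two-vertices (s≤s (s≤s _)) = zero , suc zero , λ ()
    in-edge : ∃ λ e → ∀ z → _∈ₑ_ H (ψ z) e
    in-edge = in-one-edge paths girth connected (proj₂ (proj₂ (two-vertices 3≤n)))
    e = proj₁ in-edge
    slot : Fin (vertices F) → Fin (vertices F)
    slot x = proj₁ (proj₂ in-edge x)
    slot-edge : ∀ x → edge H e (slot x) ≡ ψ x
    slot-edge x = proj₂ (proj₂ in-edge x)
    slot-injective : Injective _≡_ _≡_ slot
    slot-injective {x} {y} eq = ψ-injective (trans (sym (slot-edge x)) (trans (cong (edge H e) eq) (slot-edge y)))
    preimage : ∀ s → ∃ λ x → slot x ≡ s
    preimage = injective⇒surjective slot slot-injective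
    colour : ∀ s → χ (ψ (proj₁ (preimage s))) ≡ χ (edge H e s)
    colour s = cong χ (trans (sym (slot-edge _)) (cong (edge H e) (proj₂ (preimage s))))
    not-mono : ¬ Monochromatic {F} {graph} (χ ∘ vertex) φ
    not-mono mono with proj₁ (neither e)
    ... | s , s' , χ≢ = χ≢ (trans (sym (colour s)) (trans (mono _ _) (colour s')))
    not-rainbow : ¬ Rainbow {F} {graph} (χ ∘ vertex) φ
    not-rainbow rainbow with proj₂ (neither e)
    ... | s , s' , s≢s' , χ≡ = s≢s' (trans (sym (proj₂ (preimage s))) (trans
      (cong slot (rainbow _ _ (trans (colour s) (trans χ≡ (sym (colour s')))))) (proj₂ (preimage s'))))

-- Computing the minimum number of colours.

open Sparse using (Partite; sparse-cover)

Wminus-of-cover : ∀ {F k m} → TwoConnected F →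
  (∀ w u v → u ≢ w → v ≢ w → Σ (Reach F (_≢ w) u v) λ r → length-Reach r ≤ m) →
  (B : Hypergraph (Fin (vertices F))) (χ : V B → Fin (suc k)) → (∀ e → Neither (χ ∘ edge B e)) →
  Partite k B (2 + m) (elements (V-finite B)) →
  Σ Graph λ G → WORMColourable F G × WminusIs G F (suc k)
Wminus-of-cover {F} {k} 2-connected paths B χ χ-neither cover = graph , (suc k , colouring) , colouring ,
  -- All parts are listed, so the hypothesis of `forces` is vacuous and every `k`-colouring of the
  -- cover has a monochromatic edge.
  λ { j (s≤s j≤k) → not-worm (λ c → forces c λ v v∉ → contradiction (∈-elements (V-finite B) v) v∉) j≤k }
  where
  open Partite cover
  open Realisation F total
  total-neither : ∀ e → Neither (χ ∘ part ∘ edge total e)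
  total-neither e with χ-neither (project e)
  ... | (s , s' , χ≢) , (r , r' , r≢r' , χ≡) =
    (s , s' , λ eq → χ≢ (trans (sym (over s)) (trans eq (over s')))) ,
    (r , r' , r≢r' , trans (over r) (trans χ≡ (sym (over r'))))
    where
    over : ∀ s → χ (part (edge total e s)) ≡ χ (edge B (project e) s)
    over s = cong χ (part-edge e s)
  colouring : Σ (Colouring graph (suc k)) (IsWORM F graph)
  colouring = χ ∘ part ∘ vertex , worm paths girth 2-connected (χ ∘ part) total-neither

theorem1 : (F : Graph) → TwoConnected F → (k : ℕ) → 1 ≤ k →
    Σ Graph (λ G → WORMColourable F G × WminusIs G F k)
theorem1 F 2-connected (suc k) _
  with bounded-paths F 2-connected | base-hypergraph k (proj₁ 2-connected)
... | m , paths | B , B-not , χ , χ-neither =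
  Wminus-of-cover 2-connected paths B χ χ-neither (sparse-cover k (2 + m) fin-finite B B-not)
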